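{- For every $0<\eta<1$ and every $M<\infty$, there is a Euclidean $2$-means instance $X$ (a finite set $X\subset\mathbb{R}^d$) and a support-preserving sampling rule for choosing two centers, whose first center is chosen uniformly from $X$ and whose second (the only nontrivial) sampling round uses, for every possible first center, a distribution within total variation distance $\eta$ of the exact $D^2$-sampling distribution, such that the set $C$ of two selected centers satisfies $$\frac{\mathbf{E}[\varphi(X,C)]}{\mathrm{OPT}_2(X)}>M .$$ Thus no finite approximation guarantee depending only on $k$ and $\eta$ is possible for the relaxation of noisy $k$-means++ in which the sampling distribution of every round is only required to be within total variation distance $\eta$ of the exact one.
   Context: For finite $X\subset\mathbb{R}^d$ and a nonempty finite set $C\subset\mathbb{R}^d$, $\varphi(X,C)=\sum_{x\in X}\min_{c\in C}\|x-c\|^2$, $\varphi(x,C):=\varphi(\{x\},C)$, and $\mathrm{OPT}_k(X)=\min_{C\subset\mathbb{R}^d,|C|=k}\varphi(X,C)$. Given current centers $C_j$, the exact $D^2$-sampling distribution on $X$ is $p_{C_j}(x)=\varphi(x,C_j)/\varphi(X,C_j)$. $k$-means++ chooses the first center uniformly from $X$, and each later center from $p_{C_j}$, adding it to $C_j$. For distributions $p,q$ on a finite set $X$, $\|p-q\|_{\mathrm{TV}}=\frac12\sum_{x\in X}|p(x)-q(x)|$. A sampling rule is support-preserving if each distribution $q$ it uses has the same support as the exact distribution $p$ of that round. -}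

module Defs where

open import Data.Nat as ℕ using (ℕ; zero; suc)
import Data.Nat.Properties as ℕ
open import Data.Integer using (+_)
open import Data.Fin using (Fin)
open import Data.Product using (Σ; Σ-syntax; _×_; _,_; proj₁; proj₂)
open import Data.Sum using (inj₁; inj₂)
open import Data.Vec as Vec using (Vec; lookup)
open import Data.Vec.Functional using (Vector; foldr; head; tail; _∷_; [])
open import Data.Rational as ℚ using (ℚ; 0ℚ; 1ℚ; ½; 1/_)
import Data.Rational.Properties as ℚ
open import Data.Rational.Solver using (module +-*-Solver)
open import Function using (_∘_; _⇔_; Injective)
open import Relation.Binary.PropositionalEquality
  using (_≡_; _≢_; refl; sym; trans; cong; cong₂; subst; subst₂)
open import Relation.Nullary using (yes; no; contradiction)

open +-*-Solver using (solve; _:=_; _:+_; _:*_; _:-_; :-_; con)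

dist : ℚ → ℚ → ℚ
dist a b = ℚ.∣ a ℚ.- b ∣

dist-sym : ∀ a b → dist a b ≡ dist b a
dist-sym a b = trans (cong ℚ.∣_∣ (solve 2 (λ a b → a :- b := :- (b :- a)) refl a b))
                     (ℚ.∣-p∣≡∣p∣ (b ℚ.- a))

p≤∣p∣ : ∀ p → p ℚ.≤ ℚ.∣ p ∣
p≤∣p∣ p with ℚ.≤-total 0ℚ p
... | inj₁ 0≤p = ℚ.≤-reflexive (sym (ℚ.0≤p⇒∣p∣≡p 0≤p))
... | inj₂ p≤0 = ℚ.≤-trans p≤0 (ℚ.0≤∣p∣ p)

≤+dist : ∀ a b → a ℚ.≤ b ℚ.+ dist a b
≤+dist a b = subst (ℚ._≤ b ℚ.+ dist a b)
  (solve 2 (λ a b → b :+ (a :- b) := a) refl a b)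
  (ℚ.+-monoʳ-≤ b (p≤∣p∣ (a ℚ.- b)))

≤+⇒-≤ : ∀ {a b e} → a ℚ.≤ b ℚ.+ e → a ℚ.- b ℚ.≤ e
≤+⇒-≤ {a} {b} {e} h = subst (a ℚ.- b ℚ.≤_)
  (solve 2 (λ b e → (b :+ e) :- b := e) refl b e)
  (ℚ.+-monoˡ-≤ (ℚ.- b) h)

dist-≤ : ∀ {a b e} → a ℚ.≤ b ℚ.+ e → b ℚ.≤ a ℚ.+ e → dist a b ℚ.≤ e
dist-≤ {a} {b} {e} h k with ℚ.∣p∣≡p∨∣p∣≡-p (a ℚ.- b)
... | inj₁ eq = subst (ℚ._≤ e) (sym eq) (≤+⇒-≤ h)
... | inj₂ eq = subst (ℚ._≤ e)
  (sym (trans eq (solve 2 (λ a b → :- (a :- b) := b :- a) refl a b))) (≤+⇒-≤ k)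

dist-+ : ∀ a b c d → dist (a ℚ.+ b) (c ℚ.+ d) ℚ.≤ dist a c ℚ.+ dist b d
dist-+ a b c d = subst (ℚ._≤ dist a c ℚ.+ dist b d)
  (cong ℚ.∣_∣ (solve 4 (λ a b c d → (a :- c) :+ (b :- d) := (a :+ b) :- (c :+ d)) refl a b c d))
  (ℚ.∣p+q∣≤∣p∣+∣q∣ (a ℚ.- c) (b ℚ.- d))

dist-neg : ∀ a b → dist (ℚ.- a) (ℚ.- b) ℚ.≤ dist a b
dist-neg a b = ℚ.≤-reflexive (trans
  (cong ℚ.∣_∣ (solve 2 (λ a b → :- a :- (:- b) := b :- a) refl a b)) (dist-sym b a))

∣∣-≤ : ∀ a b → ℚ.∣ a ∣ ℚ.≤ ℚ.∣ b ∣ ℚ.+ dist a b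
∣∣-≤ a b = subst (λ z → ℚ.∣ z ∣ ℚ.≤ ℚ.∣ b ∣ ℚ.+ dist a b)
  (solve 2 (λ a b → b :+ (a :- b) := a) refl a b)
  (ℚ.∣p+q∣≤∣p∣+∣q∣ b (a ℚ.- b))

dist-abs : ∀ a b → dist ℚ.∣ a ∣ ℚ.∣ b ∣ ℚ.≤ dist a b
dist-abs a b = dist-≤ (∣∣-≤ a b)
  (subst (λ z → ℚ.∣ b ∣ ℚ.≤ ℚ.∣ a ∣ ℚ.+ z) (dist-sym b a) (∣∣-≤ b a))

p≤p+q : ∀ p {q} → 0ℚ ℚ.≤ q → p ℚ.≤ p ℚ.+ q
p≤p+q p 0≤q = subst (ℚ._≤ p ℚ.+ _) (ℚ.+-identityʳ p) (ℚ.+-monoʳ-≤ p 0≤q)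

q≤p+q : ∀ {p} q → 0ℚ ℚ.≤ p → q ℚ.≤ p ℚ.+ q
q≤p+q {p} q 0≤p = subst (ℚ._≤ p ℚ.+ q) (ℚ.+-identityˡ q) (ℚ.+-monoˡ-≤ q 0≤p)

⊓-≤ : ∀ a b c d → a ℚ.⊓ b ℚ.≤ c ℚ.⊓ d ℚ.+ (dist a c ℚ.+ dist b d)
⊓-≤ a b c d with ℚ.⊓-sel c d
... | inj₁ eq rewrite eq = ℚ.≤-trans (ℚ.p⊓q≤p a b) (ℚ.≤-trans (≤+dist a c)
        (ℚ.+-monoʳ-≤ c (p≤p+q (dist a c) (ℚ.0≤∣p∣ (b ℚ.- d)))))
... | inj₂ eq rewrite eq = ℚ.≤-trans (ℚ.p⊓q≤q a b) (ℚ.≤-trans (≤+dist b d)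
        (ℚ.+-monoʳ-≤ d (q≤p+q (dist b d) (ℚ.0≤∣p∣ (a ℚ.- c)))))

dist-⊓ : ∀ a b c d → dist (a ℚ.⊓ b) (c ℚ.⊓ d) ℚ.≤ dist a c ℚ.+ dist b d
dist-⊓ a b c d = dist-≤ (⊓-≤ a b c d)
  (subst (λ z → c ℚ.⊓ d ℚ.≤ a ℚ.⊓ b ℚ.+ z)
    (cong₂ ℚ._+_ (dist-sym c a) (dist-sym d b)) (⊓-≤ c d a b))

*-mono-≤-nonNeg : ∀ {a b c d} → 0ℚ ℚ.≤ a → 0ℚ ℚ.≤ d →
                  a ℚ.≤ b → c ℚ.≤ d → a ℚ.* c ℚ.≤ b ℚ.* d
*-mono-≤-nonNeg {a} {b} {c} {d} 0≤a 0≤d a≤b c≤d = ℚ.≤-trans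
  (ℚ.*-monoˡ-≤-nonNeg a {{ℚ.nonNegative 0≤a}} c≤d)
  (ℚ.*-monoʳ-≤-nonNeg d {{ℚ.nonNegative 0≤d}} a≤b)

0<* : ∀ {a b} → 0ℚ ℚ.< a → 0ℚ ℚ.< b → 0ℚ ℚ.< a ℚ.* b
0<* {a} {b} 0<a 0<b = subst (ℚ._< a ℚ.* b) (ℚ.*-zeroʳ a)
  (ℚ.*-monoʳ-<-pos a {{ℚ.positive 0<a}} 0<b)

dist-* : ∀ {B e} a b c d → ℚ.∣ b ∣ ℚ.≤ B → ℚ.∣ c ∣ ℚ.≤ B → dist a c ℚ.≤ e → dist b d ℚ.≤ e →
         dist (a ℚ.* b) (c ℚ.* d) ℚ.≤ e ℚ.* B ℚ.+ B ℚ.* e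
dist-* {B} {e} a b c d b≤B c≤B ac bd = ℚ.≤-trans
  (subst (ℚ._≤ ℚ.∣ (a ℚ.- c) ℚ.* b ∣ ℚ.+ ℚ.∣ c ℚ.* (b ℚ.- d) ∣)
    (cong ℚ.∣_∣ (solve 4 (λ a b c d → (a :- c) :* b :+ c :* (b :- d) := a :* b :- c :* d) refl a b c d))
    (ℚ.∣p+q∣≤∣p∣+∣q∣ ((a ℚ.- c) ℚ.* b) (c ℚ.* (b ℚ.- d))))
  (ℚ.+-mono-≤
    (subst (ℚ._≤ e ℚ.* B) (sym (ℚ.∣p*q∣≡∣p∣*∣q∣ (a ℚ.- c) b))
      (*-mono-≤-nonNeg (ℚ.0≤∣p∣ (a ℚ.- c)) 0≤B ac b≤B))
    (subst (ℚ._≤ B ℚ.* e) (sym (ℚ.∣p*q∣≡∣p∣*∣q∣ c (b ℚ.- d)))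
      (*-mono-≤-nonNeg (ℚ.0≤∣p∣ c) 0≤e c≤B bd)))
  where
  0≤B = ℚ.≤-trans (ℚ.0≤∣p∣ b) b≤B
  0≤e = ℚ.≤-trans (ℚ.0≤∣p∣ (a ℚ.- c)) ac

inv : ℚ → ℚ
inv q with q ℚ.≟ 0ℚ
... | yes _  = 0ℚ
... | no q≢0 = (1/ q) {{ℚ.≢-nonZero q≢0}}

inv-*ʳ : ∀ q → q ≢ 0ℚ → q ℚ.* inv q ≡ 1ℚ
inv-*ʳ q q≢0 with q ℚ.≟ 0ℚ
... | yes q≡0 = contradiction q≡0 q≢0
... | no q≢0′ = ℚ.*-inverseʳ q {{ℚ.≢-nonZero q≢0′}}

<⇒≢0 : ∀ {a} → 0ℚ ℚ.< a → a ≢ 0ℚ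
<⇒≢0 0<a a≡0 = ℚ.<⇒≢ 0<a (sym a≡0)

0<inv : ∀ {q} → 0ℚ ℚ.< q → 0ℚ ℚ.< inv q
0<inv {q} 0<q with q ℚ.≟ 0ℚ
... | yes q≡0 = contradiction q≡0 (<⇒≢0 0<q)
... | no q≢0  = ℚ.positive⁻¹ r {{ℚ.1/pos⇒pos q {{ℚ.positive 0<q}}}}
  where r = (1/ q) {{ℚ.≢-nonZero q≢0}}

dist-inv : ∀ {δ e} a b → 0ℚ ℚ.< δ → δ ℚ.≤ a → δ ℚ.≤ b →
           dist a b ℚ.≤ e ℚ.* (δ ℚ.* δ) → dist (inv a) (inv b) ℚ.≤ e
dist-inv {δ} {e} a b 0<δ δ≤a δ≤b ab =
  ℚ.*-cancelʳ-≤-pos (δ ℚ.* δ) {{ℚ.positive (0<* 0<δ 0<δ)}} (begin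
    dist (inv a) (inv b) ℚ.* (δ ℚ.* δ)
      ≤⟨ ℚ.*-monoˡ-≤-nonNeg (dist (inv a) (inv b)) {{ℚ.nonNegative (ℚ.0≤∣p∣ (inv a ℚ.- inv b))}}
           (*-mono-≤-nonNeg 0≤δ 0≤b δ≤a δ≤b) ⟩
    dist (inv a) (inv b) ℚ.* (a ℚ.* b)
      ≡⟨ cong (dist (inv a) (inv b) ℚ.*_) (sym (ℚ.0≤p⇒∣p∣≡p 0≤ab)) ⟩
    dist (inv a) (inv b) ℚ.* ℚ.∣ a ℚ.* b ∣
      ≡⟨ sym (ℚ.∣p*q∣≡∣p∣*∣q∣ (inv a ℚ.- inv b) (a ℚ.* b)) ⟩
    ℚ.∣ (inv a ℚ.- inv b) ℚ.* (a ℚ.* b) ∣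
      ≡⟨ cong ℚ.∣_∣ (trans
           (solve 4 (λ a b i j → (i :- j) :* (a :* b) := (a :* i) :* b :- (b :* j) :* a)
              refl a b (inv a) (inv b))
           (trans (cong₂ (λ u v → u ℚ.* b ℚ.- v ℚ.* a) (inv-*ʳ a a≢0) (inv-*ʳ b b≢0))
             (cong₂ (λ u v → u ℚ.- v) (ℚ.*-identityˡ b) (ℚ.*-identityˡ a)))) ⟩
    dist b a
      ≡⟨ dist-sym b a ⟩
    dist a b
      ≤⟨ ab ⟩
    e ℚ.* (δ ℚ.* δ) ∎)
  where
  open ℚ.≤-Reasoning
  0≤δ = ℚ.<⇒≤ 0<δ
  0≤b = ℚ.≤-trans 0≤δ δ≤b
  a≢0 = <⇒≢0 (ℚ.<-≤-trans 0<δ δ≤a)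
  b≢0 = <⇒≢0 (ℚ.<-≤-trans 0<δ δ≤b)
  0≤ab : 0ℚ ℚ.≤ a ℚ.* b
  0≤ab = ℚ.<⇒≤ (0<* (ℚ.<-≤-trans 0<δ δ≤a) (ℚ.<-≤-trans 0<δ δ≤b))

0<½* : ∀ {ε} → 0ℚ ℚ.< ε → 0ℚ ℚ.< ½ ℚ.* ε
0<½* = 0<* (ℚ.positive⁻¹ ½)

halves : ∀ ε → ½ ℚ.* ε ℚ.+ ½ ℚ.* ε ≡ ε
halves ε = trans (sym (ℚ.*-distribʳ-+ ε ½ ½)) (ℚ.*-identityˡ ε)

-- Real numbers are Cauchy sequences of rationals, compared up to null sequences.
Cauchy : (ℕ → ℚ) → Set
Cauchy s = ∀ ε → 0ℚ ℚ.< ε →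
  Σ[ N ∈ ℕ ] (∀ m n → N ℕ.≤ m → N ℕ.≤ n → dist (s m) (s n) ℚ.≤ ε)

record ℝ : Set where
  constructor mkℝ
  field
    seq      : ℕ → ℚ
    isCauchy : Cauchy seq

open ℝ public

infixl 6 _+_ _-_
infixl 7 _*_ _⊓_
infix  8 -_
infix  4 _≈_ _≤_ _<_

record _≈_ (x y : ℝ) : Set where
  constructor mk≈
  field
    close : ∀ ε → 0ℚ ℚ.< ε → Σ[ N ∈ ℕ ] (∀ n → N ℕ.≤ n → dist (seq x n) (seq y n) ℚ.≤ ε)

record _≤_ (x y : ℝ) : Set where
  constructor mk≤
  field
    below : ∀ ε → 0ℚ ℚ.< ε → Σ[ N ∈ ℕ ] (∀ n → N ℕ.≤ n → seq x n ℚ.≤ seq y n ℚ.+ ε)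

record _<_ (x y : ℝ) : Set where
  constructor mk<
  field
    gap       : ℚ
    gap>0     : 0ℚ ℚ.< gap
    from      : ℕ
    separated : ∀ n → from ℕ.≤ n → seq x n ℚ.+ gap ℚ.≤ seq y n

const-isCauchy : ∀ q → Cauchy (λ _ → q)
const-isCauchy q ε 0<ε = 0 , λ _ _ _ _ →
  ℚ.≤-trans (ℚ.≤-reflexive (cong ℚ.∣_∣ (ℚ.+-inverseʳ q))) (ℚ.<⇒≤ 0<ε)

nonexp₁-isCauchy : (f : ℚ → ℚ) → (∀ a b → dist (f a) (f b) ℚ.≤ dist a b) →
                   ∀ x → Cauchy (λ n → f (seq x n))
nonexp₁-isCauchy f nonexp x ε 0<ε =
  let (N , h) = isCauchy x ε 0<ε
  in  N , λ m n p q → ℚ.≤-trans (nonexp (seq x m) (seq x n)) (h m n p q)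

nonexp₂-isCauchy : (f : ℚ → ℚ → ℚ) →
                   (∀ a b c d → dist (f a b) (f c d) ℚ.≤ dist a c ℚ.+ dist b d) →
                   ∀ x y → Cauchy (λ n → f (seq x n) (seq y n))
nonexp₂-isCauchy f nonexp x y ε 0<ε =
  let (N , h) = isCauchy x (½ ℚ.* ε) (0<½* 0<ε)
      (M , k) = isCauchy y (½ ℚ.* ε) (0<½* 0<ε)
  in  N ℕ.⊔ M , λ m n p q → ℚ.≤-trans
        (nonexp (seq x m) (seq y m) (seq x n) (seq y n))
        (ℚ.≤-trans
          (ℚ.+-mono-≤ (h m n (ℕ.m⊔n≤o⇒m≤o N M p) (ℕ.m⊔n≤o⇒m≤o N M q))
                      (k m n (ℕ.m⊔n≤o⇒n≤o N M p) (ℕ.m⊔n≤o⇒n≤o N M q)))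
          (ℚ.≤-reflexive (halves ε)))

fromℚ : ℚ → ℝ
fromℚ q = mkℝ (λ _ → q) (const-isCauchy q)

0ℝ 1ℝ : ℝ
0ℝ = fromℚ 0ℚ
1ℝ = fromℚ 1ℚ

EventuallyBoundedBy : ℚ → (ℕ → ℚ) → Set
EventuallyBoundedBy B s = Σ[ N ∈ ℕ ] (∀ n → N ℕ.≤ n → ℚ.∣ s n ∣ ℚ.≤ B)

product-Cauchy : ∀ {s t} C → 0ℚ ℚ.< C → EventuallyBoundedBy C s → EventuallyBoundedBy C t →
                 Cauchy s → Cauchy t → Cauchy (λ n → s n ℚ.* t n)
product-Cauchy {s} {t} C 0<C (K , a) (L , b) cs ct ε 0<ε = T₁ ℕ.⊔ T₂ , λ m n p q →
  let p₁ = ℕ.m⊔n≤o⇒m≤o T₁ T₂ p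
      p₂ = ℕ.m⊔n≤o⇒n≤o T₁ T₂ p
      q₁ = ℕ.m⊔n≤o⇒m≤o T₁ T₂ q
      q₂ = ℕ.m⊔n≤o⇒n≤o T₁ T₂ q
  in ℚ.≤-trans
       (dist-* (s m) (t m) (s n) (t n)
         (b m (ℕ.m⊔n≤o⇒n≤o K L p₁))
         (a n (ℕ.m⊔n≤o⇒m≤o K L q₁))
         (proj₂ (cs e 0<e) m n (ℕ.m⊔n≤o⇒m≤o N M p₂) (ℕ.m⊔n≤o⇒m≤o N M q₂))
         (proj₂ (ct e 0<e) m n (ℕ.m⊔n≤o⇒n≤o N M p₂) (ℕ.m⊔n≤o⇒n≤o N M q₂)))
       (ℚ.≤-reflexive total≡ε)
  where
  e : ℚ
  e = ½ ℚ.* ε ℚ.* inv C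

  e*C≡½*ε : e ℚ.* C ≡ ½ ℚ.* ε
  e*C≡½*ε = trans (ℚ.*-assoc (½ ℚ.* ε) (inv C) C)
    (trans (cong (½ ℚ.* ε ℚ.*_) (trans (ℚ.*-comm (inv C) C) (inv-*ʳ C (<⇒≢0 0<C))))
           (ℚ.*-identityʳ (½ ℚ.* ε)))

  0<e : 0ℚ ℚ.< e
  0<e = 0<* (0<½* 0<ε) (0<inv 0<C)

  total≡ε : e ℚ.* C ℚ.+ C ℚ.* e ≡ ε
  total≡ε = trans (cong₂ ℚ._+_ e*C≡½*ε (trans (ℚ.*-comm C e) e*C≡½*ε)) (halves ε)

  N M T₁ T₂ : ℕ
  N = proj₁ (cs e 0<e)
  M = proj₁ (ct e 0<e)
  T₁ = K ℕ.⊔ L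
  T₂ = N ℕ.⊔ M

bound : ℝ → ℚ
bound x = ℚ.∣ seq x (proj₁ (isCauchy x 1ℚ (ℚ.positive⁻¹ 1ℚ))) ∣ ℚ.+ 1ℚ

bound>0 : ∀ x → 0ℚ ℚ.< bound x
bound>0 x = ℚ.+-mono-≤-< (ℚ.0≤∣p∣ (seq x _)) (ℚ.positive⁻¹ 1ℚ)

bounded : ∀ x {B} → bound x ℚ.≤ B → EventuallyBoundedBy B (seq x)
bounded x x≤B = let (N , h) = isCauchy x 1ℚ (ℚ.positive⁻¹ 1ℚ) in N , λ n p →
  ℚ.≤-trans (∣∣-≤ (seq x n) (seq x N))
    (ℚ.≤-trans (ℚ.+-monoʳ-≤ ℚ.∣ seq x N ∣ (h n N p ℕ.≤-refl)) x≤B)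

*-isCauchy : ∀ x y → Cauchy (λ n → seq x n ℚ.* seq y n)
*-isCauchy x y = product-Cauchy (bound x ℚ.+ bound y)
  (ℚ.+-mono-< (bound>0 x) (bound>0 y))
  (bounded x (p≤p+q (bound x) (ℚ.<⇒≤ (bound>0 y))))
  (bounded y (q≤p+q (bound y) (ℚ.<⇒≤ (bound>0 x))))
  (isCauchy x) (isCauchy y)

inv-isCauchy : ∀ y → 0ℝ < y → Cauchy (λ n → inv (seq y n))
inv-isCauchy y (mk< δ 0<δ K b) ε 0<ε =
  let (N , h) = isCauchy y (ε ℚ.* (δ ℚ.* δ)) (0<* 0<ε (0<* 0<δ 0<δ))
      δ≤ : ∀ n → K ℕ.≤ n → δ ℚ.≤ seq y n
      δ≤ n p = subst (ℚ._≤ seq y n) (ℚ.+-identityˡ δ) (b n p)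
  in  K ℕ.⊔ N , λ m n p q →
        dist-inv (seq y m) (seq y n) 0<δ
          (δ≤ m (ℕ.m⊔n≤o⇒m≤o K N p)) (δ≤ n (ℕ.m⊔n≤o⇒m≤o K N q))
          (h m n (ℕ.m⊔n≤o⇒n≤o K N p) (ℕ.m⊔n≤o⇒n≤o K N q))

-- The operations act termwise.  They are opaque only because ℚ reduces to gcd
-- computations even on variables, which makes normal forms explode.
opaque
  _+_ : ℝ → ℝ → ℝ
  x + y = mkℝ (λ n → seq x n ℚ.+ seq y n) (nonexp₂-isCauchy ℚ._+_ dist-+ x y)

  _⊓_ : ℝ → ℝ → ℝ
  x ⊓ y = mkℝ (λ n → seq x n ℚ.⊓ seq y n) (nonexp₂-isCauchy ℚ._⊓_ dist-⊓ x y)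

  -_ : ℝ → ℝ
  - x = mkℝ (λ n → ℚ.- seq x n) (nonexp₁-isCauchy ℚ.-_ dist-neg x)

  ∣_∣ : ℝ → ℝ
  ∣ x ∣ = mkℝ (λ n → ℚ.∣ seq x n ∣) (nonexp₁-isCauchy ℚ.∣_∣ dist-abs x)

  _*_ : ℝ → ℝ → ℝ
  x * y = mkℝ (λ n → seq x n ℚ.* seq y n) (*-isCauchy x y)

  -- Entries of the sequence that happen to be zero are inverted to zero; a
  -- positive real has only finitely many of them.
  recip : (y : ℝ) → 0ℝ < y → ℝ
  recip y 0<y = mkℝ (λ n → inv (seq y n)) (inv-isCauchy y 0<y)

_-_ : ℝ → ℝ → ℝ
x - y = x + (- y)

infixl 7 _/_[_]

_/_[_] : (x y : ℝ) → 0ℝ < y → ℝ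
x / y [ 0<y ] = x * recip y 0<y

∑ : ∀ {n} → Vector ℝ n → ℝ
∑ = foldr _+_ 0ℝ

minimum : ∀ {n} → Vector ℝ (suc n) → ℝ
minimum v = foldr _⊓_ (head v) (tail v)

Point : ℕ → Set
Point d = Vector ℝ d

infix 4 _≋_

_≋_ : ∀ {d} → Point d → Point d → Set
x ≋ y = ∀ l → x l ≈ y l

-- A set of n points is a family indexed by Fin n that is Distinct.
Distinct : ∀ {d n} → Vector (Point d) n → Set
Distinct = Injective _≡_ _≋_

‖_-_‖² : ∀ {d} → Point d → Point d → ℝ
‖ x - y ‖² = ∑ λ l → (x l - y l) * (x l - y l)

-- Repeated entries in C do not affect the value, so here C need not be Distinct.
φ : ∀ {d n m} → Vector (Point d) n → Vector (Point d) (suc m) → ℝ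
φ X C = ∑ λ i → minimum λ j → ‖ X i - C j ‖²

IsOPT : ∀ {d n} (k : ℕ) .{{_ : ℕ.NonZero k}} → Vector (Point d) n → ℝ → Set
IsOPT {d} (suc m) X v =
    (Σ[ C ∈ Vector (Point d) (suc m) ] (Distinct C × φ X C ≈ v))
  × ((C : Vector (Point d) (suc m)) → Distinct C → v ≤ φ X C)

record Distribution (n : ℕ) : Set where
  field
    weight : Fin n → ℝ
    nonNeg : ∀ i → 0ℝ ≤ weight i
    total  : ∑ weight ≈ 1ℝ

open Distribution public

TV : ∀ {n} → (Fin n → ℝ) → (Fin n → ℝ) → ℝ
TV p q = fromℚ ½ * ∑ λ i → ∣ p i - q i ∣

SameSupport : ∀ {n} → (Fin n → ℝ) → (Fin n → ℝ) → Set
SameSupport p q = ∀ i → 0ℝ < p i ⇔ 0ℝ < q i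

-- The distribution of the next center (an index into the data set), given the
-- centers chosen so far, most recent first.
SamplingRule : ℕ → Set
SamplingRule n = ∀ {j} → Vec (Fin n) j → Distribution n

uniform : ∀ {n} → Fin (suc n) → ℝ
uniform {n} _ = fromℚ (+ 1 ℚ./ suc n)

centers : ∀ {d n j} → Vector (Point d) n → Vec (Fin n) j → Vector (Point d) j
centers X h = X ∘ lookup h

-- The exact distribution of a round of k-means++ after history h.  It does not
-- exist when φ(X,C) = 0, that is, when every data point is already a center.
data IsExact {d n} (X : Vector (Point d) (suc n)) :
             ∀ {j} → Vec (Fin (suc n)) j → (Fin (suc n) → ℝ) → Set where
  first : IsExact X Vec.[] uniform
  later : ∀ {j} (h : Vec (Fin (suc n)) (suc j)) (0<φ : 0ℝ < φ X (centers X h)) →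
          IsExact X h (λ i → φ (X i ∷ []) (centers X h) / φ X (centers X h) [ 0<φ ])

FirstUniform : ∀ {n} → SamplingRule (suc n) → Set
FirstUniform q = ∀ i → weight (q Vec.[]) i ≈ uniform i

-- In a choice of k centers only histories of length below k occur.
SupportPreserving : ∀ {d n} → ℕ → Vector (Point d) (suc n) → SamplingRule (suc n) → Set
SupportPreserving {n = n} k X q =
  ∀ {j} (h : Vec (Fin (suc n)) j) {p} → j ℕ.< k → IsExact X h p → SameSupport (weight (q h)) p

WithinTV : ∀ {d n} → ℕ → ℝ → Vector (Point d) (suc n) → SamplingRule (suc n) → Set
WithinTV {n = n} k η X q =
  ∀ {j} (h : Vec (Fin (suc n)) j) {p} → j ℕ.< k → IsExact X h p → TV (weight (q h)) p ≤ η

-- The last round is averaged out first; F receives the latest center first.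
𝔼 : ∀ {n} k → SamplingRule n → (Vec (Fin n) k → ℝ) → ℝ
𝔼 zero    q F = F Vec.[]
𝔼 (suc k) q F = 𝔼 k q λ h → ∑ λ i → weight (q h) i * F (i Vec.∷ h)

expectedCost : ∀ {d n} (k : ℕ) .{{_ : ℕ.NonZero k}} →
               Vector (Point d) (suc n) → SamplingRule (suc n) → ℝ
expectedCost k@(suc _) X q = 𝔼 k q λ h → φ X (centers X h)

-- B bounds the expected approximation ratio of k centers chosen with every round
-- within η of the exact one.  Restricting to a uniform first center and to
-- OPT_k(X) > 0 only makes a guarantee easier to satisfy.
Guarantee : (k : ℕ) .{{_ : ℕ.NonZero k}} → ℝ → ℝ → Set
Guarantee k η B =
  ∀ {d n} (X : Vector (Point d) (suc n)) (q : SamplingRule (suc n)) {opt : ℝ} (0<opt : 0ℝ < opt) →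
  Distinct X → IsOPT k X opt → FirstUniform q → WithinTV k η X q →
  expectedCost k X q / opt [ 0<opt ] ≤ B

module Submission where

open import Defs
open import Data.Nat using (ℕ; suc; NonZero)
open import Data.Product using (Σ-syntax; _×_)
open import Data.Vec.Functional using (Vector)
open import Relation.Nullary using (¬_)

open import Data.Nat as ℕ using (zero; s≤s; z≤n)
import Data.Nat.Properties as ℕ
open import Data.Fin using (Fin; zero; suc)
import Data.Fin.Properties as Fin
open import Data.Integer as ℤ using (+_)
open import Data.Product using (_,_; proj₁; proj₂; ∃-syntax)
open import Data.Sum using (inj₁; inj₂)
open import Data.Vec as Vec using (Vec; lookup)
open import Data.Vec.Functional using (foldr; head; tail; _∷_; [])
open import Data.Rational as ℚ using (ℚ; 0ℚ; 1ℚ; ½)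
import Data.Rational.Properties as ℚ
open import Data.Rational.Solver using (module +-*-Solver)
open import Algebra.Bundles using (CommutativeRing)
open import Algebra.Properties.Semiring.Sum
  (CommutativeRing.semiring ℚ.+-*-commutativeRing)
  using (sum; sum-cong-≗; sum-replicate-zero; ∑-distrib-+; *-distribˡ-sum; *-distribʳ-sum)
open import Function using (_∘_; mk⇔)
open import Relation.Binary.PropositionalEquality
  using (_≡_; _≢_; refl; sym; trans; cong; cong₂; subst)
open import Relation.Nullary using (contradiction; yes; no)
open import Relation.Nullary.Decidable using (from-no)

open +-*-Solver using (solve; _:=_; _:+_; _:*_; _:-_; :-_; con)

-- Three points 0, 1, 1 + K on a line have OPT₂ = ½, attained by merging 0 and 1.
-- Mixing the exact distribution with a point mass at another point of {0, 1} costs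
-- at most ε in total variation and keeps the support, but from first center 0 it
-- selects 1 with probability at least ε; then the point 1 + K costs at least K.
-- Hence the expected ratio is at least of order ε K with ε ≤ η fixed and K free.
-- Apart from η, M and the competing centers all data are rational constant sequences.

-- Finite sums of rationals

0≤* : ∀ {a b} → 0ℚ ℚ.≤ a → 0ℚ ℚ.≤ b → 0ℚ ℚ.≤ a ℚ.* b
0≤* {a} {b} 0≤a 0≤b = subst (ℚ._≤ a ℚ.* b) (ℚ.*-zeroʳ a)
  (ℚ.*-monoˡ-≤-nonNeg a {{ℚ.nonNegative 0≤a}} 0≤b)

0≤square : ∀ a → 0ℚ ℚ.≤ a ℚ.* a
0≤square a = subst (0ℚ ℚ.≤_) ∣a∣∣a∣≡aa (0≤* (ℚ.0≤∣p∣ a) (ℚ.0≤∣p∣ a))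
  where
  ∣a∣∣a∣≡aa : ℚ.∣ a ∣ ℚ.* ℚ.∣ a ∣ ≡ a ℚ.* a
  ∣a∣∣a∣≡aa with ℚ.∣p∣≡p∨∣p∣≡-p a
  ... | inj₁ eq = cong₂ ℚ._*_ eq eq
  ... | inj₂ eq = trans (cong₂ ℚ._*_ eq eq)
    (solve 1 (λ a → (:- a) :* (:- a) := a :* a) refl a)

sum-mono : ∀ {n} {f g : Vector ℚ n} → (∀ i → f i ℚ.≤ g i) → sum f ℚ.≤ sum g
sum-mono {zero}  f≤g = ℚ.≤-refl
sum-mono {suc n} f≤g = ℚ.+-mono-≤ (f≤g zero) (sum-mono (f≤g ∘ suc))

sum-nonNeg : ∀ {n} {f : Vector ℚ n} → (∀ i → 0ℚ ℚ.≤ f i) → 0ℚ ℚ.≤ sum f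
sum-nonNeg {zero}  0≤f = ℚ.≤-refl
sum-nonNeg {suc n} 0≤f = ℚ.+-mono-≤ (0≤f zero) (sum-nonNeg (0≤f ∘ suc))

term≤sum : ∀ {n} (f : Vector ℚ n) → (∀ i → 0ℚ ℚ.≤ f i) → ∀ i → f i ℚ.≤ sum f
term≤sum f 0≤f zero    = p≤p+q (f zero) (sum-nonNeg (0≤f ∘ suc))
term≤sum f 0≤f (suc i) =
  ℚ.≤-trans (term≤sum (tail f) (0≤f ∘ suc) i) (q≤p+q (sum (tail f)) (0≤f zero))

two-terms≤sum : ∀ {n} (f : Vector ℚ n) → (∀ i → 0ℚ ℚ.≤ f i) →
                ∀ i j → i ≢ j → f i ℚ.+ f j ℚ.≤ sum f
two-terms≤sum f 0≤f zero    zero    i≢j = contradiction refl i≢j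
two-terms≤sum f 0≤f zero    (suc j) i≢j =
  ℚ.+-monoʳ-≤ (f zero) (term≤sum (tail f) (0≤f ∘ suc) j)
two-terms≤sum f 0≤f (suc i) zero    i≢j = subst (ℚ._≤ sum f) (ℚ.+-comm (f zero) (f (suc i)))
  (ℚ.+-monoʳ-≤ (f zero) (term≤sum (tail f) (0≤f ∘ suc) i))
two-terms≤sum f 0≤f (suc i) (suc j) i≢j =
  ℚ.≤-trans (two-terms≤sum (tail f) (0≤f ∘ suc) i j (i≢j ∘ cong suc))
            (q≤p+q (sum (tail f)) (0≤f zero))

-- The point mass at the first argument. Recursion on both indices lets its properties follow by
-- induction, without deciding equality of indices.
δ : ∀ {n} → Fin n → Fin n → ℚ
δ zero    zero    = 1ℚ
δ zero    (suc i) = 0ℚ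
δ (suc t) zero    = 0ℚ
δ (suc t) (suc i) = δ t i

0≤δ : ∀ {n} (t i : Fin n) → 0ℚ ℚ.≤ δ t i
0≤δ zero    zero    = ℚ.nonNegative⁻¹ 1ℚ
0≤δ zero    (suc i) = ℚ.≤-refl
0≤δ (suc t) zero    = ℚ.≤-refl
0≤δ (suc t) (suc i) = 0≤δ t i

δ-refl : ∀ {n} (t : Fin n) → δ t t ≡ 1ℚ
δ-refl zero    = refl
δ-refl (suc t) = δ-refl t

δ-≢ : ∀ {n} (t i : Fin n) → i ≢ t → δ t i ≡ 0ℚ
δ-≢ zero    zero    i≢t = contradiction refl i≢t
δ-≢ zero    (suc i) i≢t = refl
δ-≢ (suc t) zero    i≢t = refl
δ-≢ (suc t) (suc i) i≢t = δ-≢ t i (i≢t ∘ cong suc)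

sum-δ : ∀ {n} (t : Fin n) → sum (δ t) ≡ 1ℚ
sum-δ {suc n} zero    = cong (1ℚ ℚ.+_) (sum-replicate-zero n)
sum-δ {suc n} (suc t) = trans (ℚ.+-identityˡ (sum (δ t))) (sum-δ t)

-- Mixing a distribution with a point mass

mix : ∀ {n} → ℚ → Vector ℚ n → Fin n → Vector ℚ n
mix ε p t i = (1ℚ ℚ.- ε) ℚ.* p i ℚ.+ ε ℚ.* δ t i

module Mixture {n ε} (0<ε : 0ℚ ℚ.< ε) (ε<1 : ε ℚ.< 1ℚ)
  (p : Vector ℚ n) (0≤p : ∀ i → 0ℚ ℚ.≤ p i) (p-total : sum p ≡ 1ℚ) (t : Fin n) where

  0<1-ε : 0ℚ ℚ.< 1ℚ ℚ.- ε
  0<1-ε = subst (ℚ._< 1ℚ ℚ.- ε) (ℚ.+-inverseʳ ε) (ℚ.+-monoˡ-< (ℚ.- ε) ε<1)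

  ε*δ-nonNeg : ∀ i → 0ℚ ℚ.≤ ε ℚ.* δ t i
  ε*δ-nonNeg i = 0≤* (ℚ.<⇒≤ 0<ε) (0≤δ t i)

  mix-nonNeg : ∀ i → 0ℚ ℚ.≤ mix ε p t i
  mix-nonNeg i = ℚ.+-mono-≤ (0≤* (ℚ.<⇒≤ 0<1-ε) (0≤p i)) (ε*δ-nonNeg i)

  mix-total : sum (mix ε p t) ≡ 1ℚ
  mix-total = trans
    (∑-distrib-+ (λ i → (1ℚ ℚ.- ε) ℚ.* p i) (λ i → ε ℚ.* δ t i))
    (trans
      (cong₂ ℚ._+_
        (trans (sym (*-distribˡ-sum (1ℚ ℚ.- ε) p)) (cong ((1ℚ ℚ.- ε) ℚ.*_) p-total))
        (trans (sym (*-distribˡ-sum ε (δ t))) (cong (ε ℚ.*_) (sum-δ t))))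
      (solve 1 (λ e → (con 1ℚ :- e) :* con 1ℚ :+ e :* con 1ℚ := con 1ℚ) refl ε))

  -- The mixture differs from `p` by `ε * (δ t - p)`, and the absolute values of `δ t - p` sum to at
  -- most 2, as both vectors are nonnegative with total 1.
  mix-TV : ½ ℚ.* sum (λ i → ℚ.∣ mix ε p t i ℚ.- p i ∣) ℚ.≤ ε
  mix-TV = ℚ.≤-trans
    (ℚ.*-monoˡ-≤-nonNeg ½ (sum-mono difference≤))
    (ℚ.≤-reflexive (trans
      (cong (½ ℚ.*_) (trans
        (sym (*-distribˡ-sum ε (λ i → δ t i ℚ.+ p i)))
        (cong (ε ℚ.*_) (trans (∑-distrib-+ (δ t) p) (cong₂ ℚ._+_ (sum-δ t) p-total)))))
      (solve 1 (λ e → con ½ :* (e :* (con 1ℚ :+ con 1ℚ)) := e) refl ε)))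
    where
    difference≤ : ∀ i → ℚ.∣ mix ε p t i ℚ.- p i ∣ ℚ.≤ ε ℚ.* (δ t i ℚ.+ p i)
    difference≤ i = subst (ℚ._≤ ε ℚ.* (δ t i ℚ.+ p i))
      (trans
        (cong (ℚ._* ℚ.∣ δ t i ℚ.- p i ∣) (sym (ℚ.0≤p⇒∣p∣≡p (ℚ.<⇒≤ 0<ε))))
        (trans (sym (ℚ.∣p*q∣≡∣p∣*∣q∣ ε (δ t i ℚ.- p i)))
          (cong ℚ.∣_∣ (solve 3 (λ e d p → e :* (d :- p) := ((con 1ℚ :- e) :* p :+ e :* d) :- p)
            refl ε (δ t i) (p i)))))
      (ℚ.*-monoˡ-≤-nonNeg ε {{ℚ.nonNegative (ℚ.<⇒≤ 0<ε)}}
        (subst (ℚ.∣ δ t i ℚ.- p i ∣ ℚ.≤_)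
          (cong₂ ℚ._+_ (ℚ.0≤p⇒∣p∣≡p (0≤δ t i)) (ℚ.0≤p⇒∣p∣≡p (0≤p i)))
          (ℚ.∣p-q∣≤∣p∣+∣q∣ (δ t i) (p i))))

  -- The point mass alone contributes `ε`, however small `p t` is. For first center 0 in the
  -- instance below, the exact probability of the target is only of order `1/K²`.
  mix-target : ε ℚ.≤ mix ε p t t
  mix-target = subst (ℚ._≤ mix ε p t t)
    (trans (cong (ε ℚ.*_) (δ-refl t)) (ℚ.*-identityʳ ε))
    (q≤p+q (ε ℚ.* δ t t) (0≤* (ℚ.<⇒≤ 0<1-ε) (0≤p t)))

  mix-support⁺ : ∀ i → 0ℚ ℚ.< p i → 0ℚ ℚ.< mix ε p t i
  mix-support⁺ i 0<pi = ℚ.+-mono-<-≤ (0<* 0<1-ε 0<pi) (ε*δ-nonNeg i)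

  -- The only weight added lies at `t`, which is in the support by assumption. Elsewhere the mixture
  -- is `p` scaled by the positive factor `1 - ε`.
  mix-support⁻ : 0ℚ ℚ.< p t → ∀ i → 0ℚ ℚ.< mix ε p t i → 0ℚ ℚ.< p i
  mix-support⁻ 0<pt i 0<mix with i Fin.≟ t
  ... | yes refl = 0<pt
  ... | no i≢t   = ℚ.*-cancelˡ-<-nonNeg (1ℚ ℚ.- ε) {{ℚ.nonNegative (ℚ.<⇒≤ 0<1-ε)}}
    (subst (ℚ._< (1ℚ ℚ.- ε) ℚ.* p i) (sym (ℚ.*-zeroʳ (1ℚ ℚ.- ε)))
      (subst (0ℚ ℚ.<_)
        (trans (cong ((1ℚ ℚ.- ε) ℚ.* p i ℚ.+_)
                 (trans (cong (ε ℚ.*_) (δ-≢ t i i≢t)) (ℚ.*-zeroʳ ε)))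
               (ℚ.+-identityʳ ((1ℚ ℚ.- ε) ℚ.* p i)))
        0<mix))

-- Clustering cost over the rationals

minℚ : ∀ {n} → Vector ℚ (suc n) → ℚ
minℚ v = foldr ℚ._⊓_ (head v) (tail v)

foldr-⊓-glb : ∀ {n b a} (v : Vector ℚ n) → b ℚ.≤ a → (∀ i → b ℚ.≤ v i) → b ℚ.≤ foldr ℚ._⊓_ a v
foldr-⊓-glb {zero}  v b≤a b≤v = b≤a
foldr-⊓-glb {suc n} v b≤a b≤v = ℚ.⊓-glb (b≤v zero) (foldr-⊓-glb (tail v) b≤a (b≤v ∘ suc))

minℚ-glb : ∀ {n b} (v : Vector ℚ (suc n)) → (∀ i → b ℚ.≤ v i) → b ℚ.≤ minℚ v
minℚ-glb v b≤v = foldr-⊓-glb (tail v) (b≤v zero) (b≤v ∘ suc)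

foldr-⊓≤init : ∀ {n} a (v : Vector ℚ n) → foldr ℚ._⊓_ a v ℚ.≤ a
foldr-⊓≤init {zero}  a v = ℚ.≤-refl
foldr-⊓≤init {suc n} a v = ℚ.≤-trans (ℚ.p⊓q≤q (head v) _) (foldr-⊓≤init a (tail v))

foldr-⊓≤entry : ∀ {n} a (v : Vector ℚ n) i → foldr ℚ._⊓_ a v ℚ.≤ v i
foldr-⊓≤entry a v zero    = ℚ.p⊓q≤p (head v) _
foldr-⊓≤entry a v (suc i) = ℚ.≤-trans (ℚ.p⊓q≤q (head v) _) (foldr-⊓≤entry a (tail v) i)

minℚ≤entry : ∀ {n} (v : Vector ℚ (suc n)) i → minℚ v ℚ.≤ v i
minℚ≤entry v zero    = foldr-⊓≤init (head v) (tail v)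
minℚ≤entry v (suc i) = foldr-⊓≤entry (head v) (tail v) i

foldr-⊓-attained : ∀ {n} a (v : Vector ℚ n) → ∃[ i ] foldr ℚ._⊓_ a v ≡ (a ∷ v) i
foldr-⊓-attained {zero}  a v = zero , refl
foldr-⊓-attained {suc n} a v with ℚ.⊓-sel (head v) (foldr ℚ._⊓_ a (tail v))
... | inj₁ eq = suc zero , eq
... | inj₂ eq with foldr-⊓-attained a (tail v)
...   | zero  , eq′ = zero , trans eq eq′
-- Index `suc i` of `a ∷ tail v` is entry `i` of `tail v`, hence index `suc (suc i)` of `a ∷ v`;
-- index `zero` remains the initial value `a`.
...   | suc i , eq′ = suc (suc i) , trans eq eq′

minℚ-attained : ∀ {n} (v : Vector ℚ (suc n)) → ∃[ i ] minℚ v ≡ v i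
minℚ-attained v with foldr-⊓-attained (head v) (tail v)
... | zero  , eq = zero , eq
... | suc i , eq = suc i , eq

sqdist : ∀ {d} → Vector ℚ d → Vector ℚ d → ℚ
sqdist x y = sum λ l → (x l ℚ.- y l) ℚ.* (x l ℚ.- y l)

nearest : ∀ {d m} → Vector ℚ d → Vector (Vector ℚ d) (suc m) → ℚ
nearest x C = minℚ λ j → sqdist x (C j)

-- Rational counterpart of `φ`. By `seq-φ` it gives every term of the real cost, so cost estimates
-- can be made over the rationals, where a minimum is attained at an index that can be computed.
φℚ : ∀ {d n m} → Vector (Vector ℚ d) n → Vector (Vector ℚ d) (suc m) → ℚ
φℚ X C = sum λ i → nearest (X i) C

sqdist-nonNeg : ∀ {d} (x y : Vector ℚ d) → 0ℚ ℚ.≤ sqdist x y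
sqdist-nonNeg x y = sum-nonNeg λ l → 0≤square (x l ℚ.- y l)

nearest-nonNeg : ∀ {d m} (x : Vector ℚ d) (C : Vector (Vector ℚ d) (suc m)) → 0ℚ ℚ.≤ nearest x C
nearest-nonNeg x C = minℚ-glb (λ j → sqdist x (C j)) (λ j → sqdist-nonNeg x (C j))

φℚ-nonNeg : ∀ {d n m} (X : Vector (Vector ℚ d) n) (C : Vector (Vector ℚ d) (suc m)) → 0ℚ ℚ.≤ φℚ X C
φℚ-nonNeg X C = sum-nonNeg λ i → nearest-nonNeg (X i) C

-- 2 ((x − c)² + (y − c)²) − (x − y)² = (x + y − 2 c)²
sqdist-parallelogram : ∀ {d} (x y c : Vector ℚ d) →
                       ½ ℚ.* sqdist x y ℚ.≤ sqdist x c ℚ.+ sqdist y c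
sqdist-parallelogram x y c = subst (ℚ._≤ sqdist x c ℚ.+ sqdist y c)
  (sym (*-distribˡ-sum ½ (λ l → (x l ℚ.- y l) ℚ.* (x l ℚ.- y l))))
  (subst (_ ℚ.≤_) (∑-distrib-+ (λ l → (x l ℚ.- c l) ℚ.* (x l ℚ.- c l))
                               (λ l → (y l ℚ.- c l) ℚ.* (y l ℚ.- c l)))
    (sum-mono λ l → coordinate (x l) (y l) (c l)))
  where
  coordinate : ∀ x y c → ½ ℚ.* ((x ℚ.- y) ℚ.* (x ℚ.- y)) ℚ.≤
               (x ℚ.- c) ℚ.* (x ℚ.- c) ℚ.+ (y ℚ.- c) ℚ.* (y ℚ.- c)
  coordinate x y c = subst (½ ℚ.* ((x ℚ.- y) ℚ.* (x ℚ.- y)) ℚ.≤_)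
    (solve 3 (λ x y c →
        con ½ :* ((x :- y) :* (x :- y)) :+
        con ½ :* ((x :+ y :- (c :+ c)) :* (x :+ y :- (c :+ c)))
      := (x :- c) :* (x :- c) :+ (y :- c) :* (y :- c)) refl x y c)
    (p≤p+q (½ ℚ.* ((x ℚ.- y) ℚ.* (x ℚ.- y)))
      (0≤* (ℚ.nonNegative⁻¹ ½) (0≤square (x ℚ.+ y ℚ.- (c ℚ.+ c)))))

-- By pigeonhole some center serves two points.
φℚ-lower : ∀ {d m} (X : Vector (Vector ℚ d) (suc (suc m))) →
           (∀ i j → i ≢ j → 1ℚ ℚ.≤ sqdist (X i) (X j)) →
           ∀ C → ½ ℚ.≤ φℚ {m = m} X C
φℚ-lower {m = m} X separated C =
  let center = λ i → proj₁ (minℚ-attained (λ j → sqdist (X i) (C j)))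
      served = λ i → proj₂ (minℚ-attained (λ j → sqdist (X i) (C j)))
      (i , j , i<j , same) = Fin.pigeonhole (ℕ.n<1+n (suc m)) center
      i≢j = Fin.<⇒≢ i<j
  in  begin
    ½                                                ≤⟨ ℚ.*-monoˡ-≤-nonNeg ½ (separated i j i≢j) ⟩
    ½ ℚ.* sqdist (X i) (X j)                         ≤⟨ sqdist-parallelogram (X i) (X j) (C (center i)) ⟩
    sqdist (X i) (C (center i)) ℚ.+ sqdist (X j) (C (center i))
      -- By `same`, the center attaining the minimum for point `j` is the one attaining it for point
      -- `i`.
      ≡⟨ cong₂ ℚ._+_ (sym (served i)) (sym (trans (served j) (cong (sqdist (X j) ∘ C) (sym same)))) ⟩
    nearest (X i) C ℚ.+ nearest (X j) C
      ≤⟨ two-terms≤sum (λ i → nearest (X i) C) (λ i → nearest-nonNeg (X i) C) i j i≢j ⟩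
    φℚ X C ∎
  where open ℚ.≤-Reasoning

-- The difference `v - u` is at least `g` and at least 1, so its square is at least `g * 1`. A bound
-- linear in `g` is enough to make the bad cost grow with `K`.
square-gap : ∀ {g u v} → 1ℚ ℚ.≤ g → u ℚ.+ g ℚ.≤ v → g ℚ.≤ (v ℚ.- u) ℚ.* (v ℚ.- u)
square-gap {g} {u} {v} 1≤g u+g≤v = subst (ℚ._≤ (v ℚ.- u) ℚ.* (v ℚ.- u)) (ℚ.*-identityʳ g)
  (*-mono-≤-nonNeg 0≤g (ℚ.≤-trans 0≤g g≤v-u) g≤v-u (ℚ.≤-trans 1≤g g≤v-u))
  where
  0≤g = ℚ.≤-trans (ℚ.nonNegative⁻¹ 1ℚ) 1≤g
  g≤v-u : g ℚ.≤ v ℚ.- u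
  g≤v-u = subst (ℚ._≤ v ℚ.- u) (solve 2 (λ u g → u :+ g :- u := g) refl u g)
    (ℚ.+-monoˡ-≤ (ℚ.- u) u+g≤v)

-- Reals as sequences

≈-fromSeq : ∀ {x y} → (∀ n → seq x n ≡ seq y n) → x ≈ y
≈-fromSeq {x} {y} eq = mk≈ λ ε 0<ε → 0 , λ n _ → ℚ.≤-trans
  (ℚ.≤-reflexive (trans (cong (λ a → dist a (seq y n)) (eq n))
                        (cong ℚ.∣_∣ (ℚ.+-inverseʳ (seq y n)))))
  (ℚ.<⇒≤ 0<ε)

≤-fromSeq : ∀ {x y} N → (∀ n → N ℕ.≤ n → seq x n ℚ.≤ seq y n) → x ≤ y
≤-fromSeq {y = y} N x≤y = mk≤ λ ε 0<ε → N , λ n N≤n →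
  ℚ.≤-trans (x≤y n N≤n) (p≤p+q (seq y n) (ℚ.<⇒≤ 0<ε))

½*<id : ∀ {g} → 0ℚ ℚ.< g → ½ ℚ.* g ℚ.< g
½*<id {g} 0<g = subst (½ ℚ.* g ℚ.<_) (halves g)
  (subst (ℚ._< ½ ℚ.* g ℚ.+ ½ ℚ.* g) (ℚ.+-identityʳ (½ ℚ.* g))
    (ℚ.+-monoʳ-< (½ ℚ.* g) (0<½* 0<g)))

-- At an index past both thresholds, the gap `g` of the strict inequality exceeds the slack `½ * g`
-- allowed by the weak one.
<⇒≱ : ∀ {x y} → x < y → ¬ y ≤ x
<⇒≱ {x} {y} (mk< g 0<g N x+g≤y) y≤x =
  let (N′ , y≤x+½g) = _≤_.below y≤x (½ ℚ.* g) (0<½* 0<g)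
      n   = N ℕ.⊔ N′
  in  ℚ.<-irrefl refl (begin-strict
        seq x n ℚ.+ g              ≤⟨ x+g≤y n (ℕ.m≤m⊔n N N′) ⟩
        seq y n                    ≤⟨ y≤x+½g n (ℕ.m≤n⊔m N N′) ⟩
        seq x n ℚ.+ ½ ℚ.* g        <⟨ ℚ.+-monoʳ-< (seq x n) (½*<id 0<g) ⟩
        seq x n ℚ.+ g              ∎)
  where open ℚ.≤-Reasoning

-- Equality of rationals is decidable. If `a` and `b` differ, their distance is positive, and
-- closeness at half that distance is absurd.
fromℚ-injective : ∀ {a b} → fromℚ a ≈ fromℚ b → a ≡ b
fromℚ-injective {a} {b} a≈b with a ℚ.≟ b
... | yes a≡b = a≡b
... | no a≢b  = contradiction dist≤½*dist λ d≤½*d → ℚ.<-irrefl refl (ℚ.≤-<-trans d≤½*d (½*<id 0<dist))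
  where
  a-b≢0 : a ℚ.- b ≢ 0ℚ
  a-b≢0 a-b≡0 = a≢b (trans (solve 2 (λ a b → a := a :- b :+ b) refl a b)
    (trans (cong (ℚ._+ b) a-b≡0) (ℚ.+-identityˡ b)))

  0<dist : 0ℚ ℚ.< dist a b
  0<dist = ℚ.≰⇒> λ d≤0 → a-b≢0 (ℚ.∣p∣≡0⇒p≡0 (a ℚ.- b) (ℚ.≤-antisym d≤0 (ℚ.0≤∣p∣ (a ℚ.- b))))

  dist≤½*dist : dist a b ℚ.≤ ½ ℚ.* dist a b
  dist≤½*dist = let (N , close) = _≈_.close a≈b _ (0<½* 0<dist) in close N ℕ.≤-refl

-- Stated for any real whose terms all equal `a`, rather than for `fromℚ a`, so that it also applies
-- to the quotients in `IsExact`, whose operations are opaque.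
constant-positive⁺ : ∀ {x a} → (∀ n → seq x n ≡ a) → 0ℚ ℚ.< a → 0ℝ < x
constant-positive⁺ {a = a} x≡a 0<a = mk< a 0<a 0 λ n _ →
  ℚ.≤-reflexive (trans (ℚ.+-identityˡ a) (sym (x≡a n)))

constant-positive⁻ : ∀ {x a} → (∀ n → seq x n ≡ a) → 0ℝ < x → 0ℚ ℚ.< a
constant-positive⁻ x≡a (mk< g 0<g N g≤x) = ℚ.<-≤-trans 0<g
  (subst (ℚ._≤ _) (ℚ.+-identityˡ g) (subst (0ℚ ℚ.+ g ℚ.≤_) (x≡a N) (g≤x N ℕ.≤-refl)))

-- The gap witnessing `0ℝ < x` is itself such a rational. Applied to `η`, it supplies the mixing
-- weight `ε`.
<⇒rational-below : ∀ {x} → 0ℝ < x → ∃[ ε ] 0ℚ ℚ.< ε × fromℚ ε ≤ x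
<⇒rational-below (mk< g 0<g N g≤x) = g , 0<g , ≤-fromSeq N λ n N≤n →
  subst (ℚ._≤ _) (ℚ.+-identityˡ g) (g≤x n N≤n)

-- Half of the gap between `x` and `b` absorbs the slack in `fromℚ a ≤ x`. This yields `ε < 1` from
-- `ε ≤ η < 1`.
≤-<-rational : ∀ {a x b} → fromℚ a ≤ x → x < fromℚ b → a ℚ.< b
≤-<-rational {a} {x} {b} a≤x (mk< g 0<g N x+g≤b) =
  let (N′ , a≤x+½g) = _≤_.below a≤x (½ ℚ.* g) (0<½* 0<g)
      n = N ℕ.⊔ N′
  in  begin-strict
        a                          ≤⟨ a≤x+½g n (ℕ.m≤n⊔m N N′) ⟩
        seq x n ℚ.+ ½ ℚ.* g        <⟨ ℚ.+-monoʳ-< (seq x n) (½*<id 0<g) ⟩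
        seq x n ℚ.+ g              ≤⟨ x+g≤b n (ℕ.m≤m⊔n N N′) ⟩
        b                          ∎
  where
  open ℚ.≤-Reasoning

-- Termwise evaluation of the real operations

opaque
  unfolding _+_ _⊓_ -_ ∣_∣ _*_ recip

  -- These equations hold by computation once the operations are unfolded. All later reasoning goes
  -- through them and keeps the operations opaque.
  seq-+ : ∀ x y n → seq (x + y) n ≡ seq x n ℚ.+ seq y n
  seq-+ x y n = refl

  seq-⊓ : ∀ x y n → seq (x ⊓ y) n ≡ seq x n ℚ.⊓ seq y n
  seq-⊓ x y n = refl

  seq-neg : ∀ x n → seq (- x) n ≡ ℚ.- seq x n
  seq-neg x n = refl

  seq-∣∣ : ∀ x n → seq ∣ x ∣ n ≡ ℚ.∣ seq x n ∣
  seq-∣∣ x n = refl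

  seq-* : ∀ x y n → seq (x * y) n ≡ seq x n ℚ.* seq y n
  seq-* x y n = refl

  seq-recip : ∀ y 0<y n → seq (recip y 0<y) n ≡ inv (seq y n)
  seq-recip y 0<y n = refl

seq-- : ∀ x y n → seq (x - y) n ≡ seq x n ℚ.- seq y n
seq-- x y n = trans (seq-+ x (- y) n) (cong (seq x n ℚ.+_) (seq-neg y n))

seq-/ : ∀ x y 0<y n → seq (x / y [ 0<y ]) n ≡ seq x n ℚ.* inv (seq y n)
seq-/ x y 0<y n =
  trans (seq-* x (recip y 0<y) n) (cong (seq x n ℚ.*_) (seq-recip y 0<y n))

seq-∑ : ∀ {m} (v : Vector ℝ m) n → seq (∑ v) n ≡ sum (λ i → seq (v i) n)
seq-∑ {zero}  v n = refl
seq-∑ {suc m} v n =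
  trans (seq-+ (v zero) (∑ (tail v)) n) (cong (seq (v zero) n ℚ.+_) (seq-∑ (tail v) n))

seq-∑-cong : ∀ {m n} (v : Vector ℝ m) {a} → (∀ i → seq (v i) n ≡ a i) → seq (∑ v) n ≡ sum a
seq-∑-cong {n = n} v v≡a = trans (seq-∑ v n) (sum-cong-≗ v≡a)

seq-foldr-⊓ : ∀ {m n x a} (v : Vector ℝ m) {b : Vector ℚ m} → seq x n ≡ a → (∀ i → seq (v i) n ≡ b i) →
              seq (foldr _⊓_ x v) n ≡ foldr ℚ._⊓_ a b
seq-foldr-⊓ {zero}  v x≡a v≡b = x≡a
seq-foldr-⊓ {suc m} {n} {x} v x≡a v≡b =
  trans (seq-⊓ (v zero) (foldr _⊓_ x (tail v)) n)
        (cong₂ ℚ._⊓_ (v≡b zero) (seq-foldr-⊓ (tail v) x≡a (v≡b ∘ suc)))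

at : ∀ {d m} → ℕ → Vector (Point d) m → Vector (Vector ℚ d) m
at n X i l = seq (X i l) n

-- Every operation in `φ` acts termwise. Hence a lower bound valid for all rational centers
-- transfers, term by term, to arbitrary real centers.
seq-φ : ∀ {d m k} (X : Vector (Point d) m) (C : Vector (Point d) (suc k)) n →
        seq (φ X C) n ≡ φℚ (at n X) (at n C)
seq-φ X C n = seq-∑-cong (λ i → minimum λ j → ‖ X i - C j ‖²) λ i →
  seq-foldr-⊓ (tail λ j → ‖ X i - C j ‖²) (seq-‖‖² i zero) (λ j → seq-‖‖² i (suc j))
  where
  seq-‖‖² : ∀ i j → seq ‖ X i - C j ‖² n ≡ sqdist (at n X i) (at n C j)
  seq-‖‖² i j = seq-∑-cong (λ l → (X i l - C j l) * (X i l - C j l)) λ l →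
    trans (seq-* (X i l - C j l) (X i l - C j l) n)
          (cong₂ ℚ._*_ (seq-- (X i l) (C j l) n) (seq-- (X i l) (C j l) n))

seq-TV : ∀ {m n} (p q : Fin m → ℝ) {a b : Fin m → ℚ} →
         (∀ i → seq (p i) n ≡ a i) → (∀ i → seq (q i) n ≡ b i) →
         seq (TV p q) n ≡ ½ ℚ.* sum (λ i → ℚ.∣ a i ℚ.- b i ∣)
seq-TV {n = n} p q p≡a q≡b = trans (seq-* (fromℚ ½) (∑ λ i → ∣ p i - q i ∣) n)
  (cong (½ ℚ.*_) (seq-∑-cong (λ i → ∣ p i - q i ∣) λ i →
    trans (seq-∣∣ (p i - q i) n)
      (cong ℚ.∣_∣ (trans (seq-- (p i) (q i) n) (cong₂ ℚ._-_ (p≡a i) (q≡b i))))))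

rationalDistribution : ∀ {n} (w : Vector ℚ n) → (∀ i → 0ℚ ℚ.≤ w i) → sum w ≡ 1ℚ → Distribution n
rationalDistribution w 0≤w w-total = record
  { weight = fromℚ ∘ w
  ; nonNeg = λ i → ≤-fromSeq 0 λ _ _ → 0≤w i
  ; total  = ≈-fromSeq λ n → trans (seq-∑ (fromℚ ∘ w) n) w-total
  }

-- The points 0, 1, 1 + K on a line

module Instance {ε K : ℚ} (0<ε : 0ℚ ℚ.< ε) (ε<1 : ε ℚ.< 1ℚ) (1≤K : 1ℚ ℚ.≤ K) where

  coordinate : Vector ℚ 3
  coordinate = 0ℚ ∷ 1ℚ ∷ 1ℚ ℚ.+ K ∷ []

  -- The rational version of the instance: `at n X` computes to `P` for every `n`.
  P : Vector (Vector ℚ 1) 3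
  P i _ = coordinate i

  X : Vector (Point 1) 3
  X i _ = fromℚ (coordinate i)

  sqdist-gap : ∀ {g} i j → 1ℚ ℚ.≤ g → coordinate j ℚ.+ g ℚ.≤ coordinate i → g ℚ.≤ sqdist (P i) (P j)
  -- In dimension one `sqdist` is a single square plus an empty sum, which `+-identityʳ` removes.
  sqdist-gap {g} i j 1≤g gap = subst (g ℚ.≤_) (sym (ℚ.+-identityʳ _)) (square-gap 1≤g gap)

  sqdist-sym : ∀ i j → sqdist (P i) (P j) ≡ sqdist (P j) (P i)
  sqdist-sym i j = cong (ℚ._+ 0ℚ) (solve 2 (λ x y → (x :- y) :* (x :- y) := (y :- x) :* (y :- x))
    refl (coordinate i) (coordinate j))

  1≤1+K : 1ℚ ℚ.≤ 1ℚ ℚ.+ K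
  1≤1+K = p≤p+q 1ℚ (ℚ.≤-trans (ℚ.nonNegative⁻¹ 1ℚ) 1≤K)

  -- Pairs whose first point lies to the right are compared directly, the others by symmetry. The
  -- bound serves `φℚ-lower`, the distinctness of the points and the positivity of the `D²` weights.
  separated : ∀ i j → i ≢ j → 1ℚ ℚ.≤ sqdist (P i) (P j)
  separated zero zero i≢j = contradiction refl i≢j
  separated (suc zero) zero _ = sqdist-gap (suc zero) zero ℚ.≤-refl ℚ.≤-refl
  separated (suc (suc zero)) zero _ = sqdist-gap (suc (suc zero)) zero ℚ.≤-refl 1≤1+K
  separated (suc (suc zero)) (suc zero) _ =
    sqdist-gap (suc (suc zero)) (suc zero) ℚ.≤-refl (ℚ.+-monoʳ-≤ 1ℚ 1≤K)
  separated (suc zero) (suc zero) i≢j = contradiction refl i≢j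
  separated (suc (suc zero)) (suc (suc zero)) i≢j = contradiction refl i≢j
  separated zero (suc zero) i≢j =
    subst (1ℚ ℚ.≤_) (sqdist-sym (suc zero) zero) (separated (suc zero) zero (i≢j ∘ sym))
  separated zero (suc (suc zero)) i≢j =
    subst (1ℚ ℚ.≤_) (sqdist-sym (suc (suc zero)) zero) (separated (suc (suc zero)) zero (i≢j ∘ sym))
  separated (suc zero) (suc (suc zero)) i≢j = subst (1ℚ ℚ.≤_)
    (sqdist-sym (suc (suc zero)) (suc zero)) (separated (suc (suc zero)) (suc zero) (i≢j ∘ sym))

  X-distinct : Distinct X
  X-distinct {i} {j} Xi≋Xj with i Fin.≟ j
  ... | yes i≡j = i≡j
  ... | no i≢j  = contradiction
    (subst (1ℚ ℚ.≤_) (sqdist-≡ (fromℚ-injective (Xi≋Xj zero))) (separated i j i≢j))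
    (from-no (1ℚ ℚ.≤? 0ℚ))
    where
    sqdist-≡ : coordinate i ≡ coordinate j → sqdist (P i) (P j) ≡ 0ℚ
    sqdist-≡ eq = trans (cong (λ x → (x ℚ.- coordinate j) ℚ.* (x ℚ.- coordinate j) ℚ.+ 0ℚ) eq)
      (solve 1 (λ x → (x :- x) :* (x :- x) :+ con 0ℚ := con 0ℚ) refl (coordinate j))

  -- The midpoint of the two near points, and the far point.
  C* : Vector (Vector ℚ 1) 2
  C* = (λ _ → ½) ∷ P (suc (suc zero)) ∷ []

  φℚ-C*≤½ : φℚ P C* ℚ.≤ ½
  -- The bounds ¼, ¼ and 0 for the three points add up to `½` by computation.
  φℚ-C*≤½ = sum-mono {f = λ i → nearest (P i) C*} {g = ½ ℚ.* ½ ∷ ½ ℚ.* ½ ∷ 0ℚ ∷ []} λ where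
    zero             → minℚ≤entry (λ j → sqdist (P zero) (C* j)) zero
    (suc zero)       → minℚ≤entry (λ j → sqdist (P (suc zero)) (C* j)) zero
    (suc (suc zero)) → subst (nearest (P (suc (suc zero))) C* ℚ.≤_)
      (solve 1 (λ x → (x :- x) :* (x :- x) :+ con 0ℚ := con 0ℚ) refl (1ℚ ℚ.+ K))
      (minℚ≤entry (λ j → sqdist (P (suc (suc zero))) (C* j)) (suc zero))

  OPT₂≡½ : IsOPT 2 X (fromℚ ½)
  OPT₂≡½ =
      ( centers* , distinct
      , ≈-fromSeq λ n → trans (seq-φ X centers* n)
          (ℚ.≤-antisym φℚ-C*≤½ (φℚ-lower P separated C*)))
    -- The competing centers are real, so the pigeonhole bound is applied to each rational
    -- approximation `at n C`.
    , λ C _ → ≤-fromSeq 0 λ n _ →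
        subst (½ ℚ.≤_) (sym (seq-φ X C n)) (φℚ-lower P separated (at n C))
    where
    centers* : Vector (Point 1) 2
    centers* j l = fromℚ (C* j l)

    ½≢1+K : ½ ≢ 1ℚ ℚ.+ K
    ½≢1+K eq = contradiction (subst (1ℚ ℚ.≤_) (sym eq) 1≤1+K) (from-no (1ℚ ℚ.≤? ½))

    distinct : Distinct centers*
    distinct {zero}     {zero}     _  = refl
    distinct {zero}     {suc zero} eq = contradiction (fromℚ-injective (eq zero)) ½≢1+K
    distinct {suc zero} {zero}     eq = contradiction (sym (fromℚ-injective (eq zero))) ½≢1+K
    distinct {suc zero} {suc zero} _  = refl

  -- The exact and the noisy second round

  target : Fin 3 → Fin 3
  -- From 0 the boosted point is 1, which leaves the far point without a nearby center. From the
  -- other first centers, any point other than the center is in the support and would do.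
  target zero    = suc zero
  target (suc _) = zero

  target≢ : ∀ c → target c ≢ c
  target≢ zero    ()
  target≢ (suc _) ()

  single : Fin 3 → Vector (Vector ℚ 1) 1
  single c _ = P c

  exact : Fin 3 → Vector ℚ 3
  exact c i = nearest (P i) (single c) ℚ.* inv (φℚ P (single c))

  0<nearest-target : ∀ c → 0ℚ ℚ.< nearest (P (target c)) (single c)
  -- For a single center, `nearest` computes to `sqdist`.
  0<nearest-target c = ℚ.<-≤-trans (ℚ.positive⁻¹ 1ℚ) (separated (target c) c (target≢ c))

  0<φℚ-single : ∀ c → 0ℚ ℚ.< φℚ P (single c)
  0<φℚ-single c = ℚ.<-≤-trans (0<nearest-target c)
    (term≤sum (λ i → nearest (P i) (single c)) (λ i → nearest-nonNeg (P i) (single c)) (target c))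

  exact-nonNeg : ∀ c i → 0ℚ ℚ.≤ exact c i
  exact-nonNeg c i = 0≤* (nearest-nonNeg (P i) (single c)) (ℚ.<⇒≤ (0<inv (0<φℚ-single c)))

  exact-total : ∀ c → sum (exact c) ≡ 1ℚ
  exact-total c = trans
    (sym (*-distribʳ-sum (inv (φℚ P (single c))) (λ i → nearest (P i) (single c))))
    (inv-*ʳ (φℚ P (single c)) (<⇒≢0 (0<φℚ-single c)))

  -- The premise of `mix-support⁻`: the boosted point already has positive exact probability.
  0<exact-target : ∀ c → 0ℚ ℚ.< exact c (target c)
  0<exact-target c = 0<* (0<nearest-target c) (0<inv (0<φℚ-single c))

  noisy : Fin 3 → Vector ℚ 3
  noisy c = mix ε (exact c) (target c)

  module Noisy (c : Fin 3) = Mixture 0<ε ε<1 (exact c) (exact-nonNeg c) (exact-total c) (target c)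

  ⅓ : ℚ
  ⅓ = + 1 ℚ./ 3

  uniformDistribution : Distribution 3
  uniformDistribution = rationalDistribution (λ _ → ⅓) (λ _ → ℚ.nonNegative⁻¹ ⅓) refl

  rule : SamplingRule 3
  rule Vec.[]               = uniformDistribution
  rule (c Vec.∷ Vec.[])     = rationalDistribution (noisy c) (Noisy.mix-nonNeg c)
    (Noisy.mix-total c)
  -- A default value: histories of length two or more do not occur in a choice of two centers.
  rule (_ Vec.∷ _ Vec.∷ _)  = uniformDistribution

  rule-firstUniform : FirstUniform rule
  rule-firstUniform i = ≈-fromSeq λ _ → refl

  -- The quotient in `IsExact` is a constant sequence. The positivity proof is arbitrary because the
  -- constructor `later` carries its own.
  seq-exact : ∀ c 0<φ i n → seq (φ (X i ∷ []) (centers X (c Vec.∷ Vec.[])) /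
                                 φ X (centers X (c Vec.∷ Vec.[])) [ 0<φ ]) n ≡ exact c i
  seq-exact c 0<φ i n = trans
    (seq-/ (φ (X i ∷ []) C) (φ X C) 0<φ n)
    (cong₂ (λ u v → u ℚ.* inv v)
      (trans (seq-φ (X i ∷ []) C n) (trans (ℚ.+-identityʳ _) (nearest-C i)))
      (trans (seq-φ X C n) (sum-cong-≗ nearest-C)))
    where
    C = centers X (c Vec.∷ Vec.[])
    nearest-C : ∀ i → nearest (P i) (at n C) ≡ nearest (P i) (single c)
    nearest-C i = refl

  rule-supportPreserving : SupportPreserving 2 X rule
  rule-supportPreserving Vec.[] _ first i = mk⇔ (λ 0<⅓ → 0<⅓) (λ 0<⅓ → 0<⅓)
  rule-supportPreserving (c Vec.∷ Vec.[]) _ (later _ 0<φ) i = mk⇔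
    (λ 0<q → constant-positive⁺ (seq-exact c 0<φ i)
      (Noisy.mix-support⁻ c (0<exact-target c) i
        (constant-positive⁻ (λ _ → refl) 0<q)))
    (λ 0<p → constant-positive⁺ (λ _ → refl)
      (Noisy.mix-support⁺ c i
        (constant-positive⁻ (seq-exact c 0<φ i) 0<p)))
  rule-supportPreserving (_ Vec.∷ _ Vec.∷ _) (s≤s (s≤s ())) _

  -- Every term of the distance is a rational at most `ε`, and `ε ≤ η` holds as reals; `≤-transfer`
  -- composes the two.
  rule-withinTV : ∀ {η} → fromℚ ε ≤ η → WithinTV 2 η X rule
  rule-withinTV ε≤η h j<2 isExact = ≤-transfer ε≤η λ n → TV≤ε h j<2 isExact n
    where
    ≤-transfer : ∀ {x η} → fromℚ ε ≤ η → (∀ n → seq x n ℚ.≤ ε) → x ≤ η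
    ≤-transfer ε≤η x≤ε = mk≤ λ e 0<e → let (N , ε≤η+e) = _≤_.below ε≤η e 0<e in
      N , λ n N≤n → ℚ.≤-trans (x≤ε n) (ε≤η+e n N≤n)

    TV≤ε : ∀ {j} (h : Vec (Fin 3) j) {p} → j ℕ.< 2 → IsExact X h p →
           ∀ n → seq (TV (weight (rule h)) p) n ℚ.≤ ε
    -- The first round is exact, so its distance computes to 0.
    TV≤ε Vec.[] _ first n = subst (ℚ._≤ ε)
      (sym (seq-TV (weight uniformDistribution) uniform (λ _ → refl) (λ _ → refl))) (ℚ.<⇒≤ 0<ε)
    TV≤ε (c Vec.∷ Vec.[]) {p} _ (later _ 0<φ) n =
      subst (ℚ._≤ ε) (sym (seq-TV (weight (rule (c Vec.∷ Vec.[]))) p (λ _ → refl) (λ i → seq-exact c 0<φ i n)))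
        (Noisy.mix-TV c)
    TV≤ε (_ Vec.∷ _ Vec.∷ _) (s≤s (s≤s ())) _

  -- The expected cost of the rule

  pair : Fin 3 → Fin 3 → Vector (Vector ℚ 1) 2
  pair i c = P ∘ lookup (i Vec.∷ c Vec.∷ Vec.[])

  secondRound : Fin 3 → ℚ
  secondRound c = sum λ i → noisy c i ℚ.* φℚ P (pair i c)

  -- `𝔼 2` unfolds to a double sum with the first center outside and the second inside, so the
  -- termwise rules apply twice.
  seq-expectedCost : ∀ n → seq (expectedCost 2 X rule) n ≡ sum λ c → ⅓ ℚ.* secondRound c
  seq-expectedCost n =
    seq-weighted uniformDistribution
        (λ c → ∑ λ i → weight (rule (c Vec.∷ Vec.[])) i * φ X (centers X (i Vec.∷ c Vec.∷ Vec.[])))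
      λ c → seq-weighted (rule (c Vec.∷ Vec.[])) (λ i → φ X (centers X (i Vec.∷ c Vec.∷ Vec.[])))
      λ i → seq-φ X (centers X (i Vec.∷ c Vec.∷ Vec.[])) n
    where
    seq-weighted : (μ : Distribution 3) (F : Fin 3 → ℝ) {a : Fin 3 → ℚ} →
                   (∀ i → seq (F i) n ≡ a i) →
                   seq (∑ λ i → weight μ i * F i) n ≡ sum λ i → seq (weight μ i) n ℚ.* a i
    seq-weighted μ F F≡a = seq-∑-cong (λ i → weight μ i * F i) λ i →
      trans (seq-* (weight μ i) (F i) n) (cong (seq (weight μ i) n ℚ.*_) (F≡a i))

  -- With centers 0 and 1, the point `1 + K` is at distance at least `K` from both, and `square-gap`
  -- bounds its cost below.
  K≤bad-cost : K ℚ.≤ φℚ P (pair (suc zero) zero)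
  K≤bad-cost = ℚ.≤-trans
    (minℚ-glb (λ j → sqdist (P (suc (suc zero))) (pair (suc zero) zero j)) λ where
      zero       → sqdist-gap (suc (suc zero)) (suc zero) 1≤K ℚ.≤-refl
      (suc zero) → sqdist-gap (suc (suc zero)) zero 1≤K
                     (ℚ.+-monoˡ-≤ K (ℚ.nonNegative⁻¹ 1ℚ)))
    (term≤sum (λ i → nearest (P i) C) (λ i → nearest-nonNeg (P i) C) (suc (suc zero)))
    where C = pair (suc zero) zero

  -- Only one outcome of the double sum is kept: first center 0 with probability `⅓`, then center 1
  -- with probability at least `ε`, at cost at least `K`. All other terms are nonnegative.
  expectedCost-lower : ∀ n → ⅓ ℚ.* (ε ℚ.* K) ℚ.≤ seq (expectedCost 2 X rule) n
  expectedCost-lower n = subst (⅓ ℚ.* (ε ℚ.* K) ℚ.≤_) (sym (seq-expectedCost n)) (ℚ.≤-trans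
    (ℚ.*-monoˡ-≤-nonNeg ⅓ (ℚ.≤-trans
      (*-mono-≤-nonNeg (ℚ.<⇒≤ 0<ε) (φℚ-nonNeg P (pair (suc zero) zero))
        (Noisy.mix-target zero)
        K≤bad-cost)
      (term≤sum (λ i → noisy zero i ℚ.* φℚ P (pair i zero)) (term-nonNeg zero) (suc zero))))
    (term≤sum (λ c → ⅓ ℚ.* secondRound c)
      (λ c → 0≤* (ℚ.nonNegative⁻¹ ⅓) (sum-nonNeg (term-nonNeg c))) zero))
    where
    term-nonNeg : ∀ c i → 0ℚ ℚ.≤ noisy c i ℚ.* φℚ P (pair i c)
    term-nonNeg c i = 0≤* (Noisy.mix-nonNeg c i) (φℚ-nonNeg P (pair i c))

  0<½ : 0ℝ < fromℚ ½
  0<½ = constant-positive⁺ (λ _ → refl) (ℚ.positive⁻¹ ½)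

  ratio-lower : ∀ n → ⅓ ℚ.* (ε ℚ.* K) ℚ.≤ seq (expectedCost 2 X rule / fromℚ ½ [ 0<½ ]) n
  ratio-lower n = subst (⅓ ℚ.* (ε ℚ.* K) ℚ.≤_) (sym (seq-/ (expectedCost 2 X rule) (fromℚ ½) 0<½ n))
    (ℚ.≤-trans (expectedCost-lower n)
      (subst (ℚ._≤ cost ℚ.* inv ½) (ℚ.*-identityʳ cost)
        -- Only `1ℚ ≤ inv ½` is used of the division by the optimum; it reduces to comparing the
        -- integers 1 and 2.
        (ℚ.*-monoˡ-≤-nonNeg cost {{ℚ.nonNegative 0≤cost}} (ℚ.*≤* (ℤ.+≤+ (s≤s z≤n))))))
    where
    cost = seq (expectedCost 2 X rule) n
    0≤cost : 0ℚ ℚ.≤ cost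
    0≤cost = ℚ.≤-trans
      (0≤* (ℚ.nonNegative⁻¹ ⅓) (0≤* (ℚ.<⇒≤ 0<ε) (ℚ.≤-trans (ℚ.nonNegative⁻¹ 1ℚ) 1≤K)))
      (expectedCost-lower n)

-- Choice of the parameters and the theorem

unbounded-ratio : (η : ℝ) → 0ℝ < η → η < 1ℝ → (M : ℝ) →
  Σ[ d ∈ ℕ ] Σ[ n ∈ ℕ ] Σ[ X ∈ Vector (Point d) (suc n) ] Σ[ q ∈ SamplingRule (suc n) ]
  Σ[ opt ∈ ℝ ] Σ[ 0<opt ∈ 0ℝ < opt ]
    ( Distinct X × IsOPT 2 X opt × FirstUniform q × SupportPreserving 2 X q × WithinTV 2 η X q
    × M < expectedCost 2 X q / opt [ 0<opt ] )
unbounded-ratio η 0<η η<1 M with <⇒rational-below 0<η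
... | ε , 0<ε , ε≤η =
  1 , 2 , X , rule , fromℚ ½ , 0<½ , X-distinct , OPT₂≡½ , rule-firstUniform ,
  rule-supportPreserving , rule-withinTV ε≤η ,
  -- The gap is 1: eventually the terms of `M` are at most `bound M`, which is `B - 1`, while every
  -- term of the ratio is at least `B`.
  mk< 1ℚ (ℚ.positive⁻¹ 1ℚ) (proj₁ M-bounded) λ n N≤n →
    ℚ.≤-trans (ℚ.+-monoˡ-≤ 1ℚ (ℚ.≤-trans (p≤∣p∣ (seq M n)) (proj₂ M-bounded n N≤n)))
      (ℚ.≤-trans B≤⅓εK (ratio-lower n))
  where
  M-bounded = bounded M ℚ.≤-refl

  B 3ℚ K : ℚ
  B  = bound M ℚ.+ 1ℚ
  3ℚ = + 3 ℚ./ 1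
  -- The factor 3 and `inv ε` cancel the probabilities `⅓` and `ε`, leaving `B` plus a positive
  -- remainder. The leading 1 ensures `1 ≤ K`.
  K  = 1ℚ ℚ.+ 3ℚ ℚ.* (B ℚ.* inv ε)

  0≤B : 0ℚ ℚ.≤ B
  0≤B = ℚ.+-mono-≤ (ℚ.<⇒≤ (bound>0 M)) (ℚ.nonNegative⁻¹ 1ℚ)

  1≤K : 1ℚ ℚ.≤ K
  1≤K = p≤p+q 1ℚ (0≤* (ℚ.nonNegative⁻¹ 3ℚ) (0≤* 0≤B (ℚ.<⇒≤ (0<inv 0<ε))))

  open Instance 0<ε (≤-<-rational ε≤η η<1) 1≤K

  ⅓εK≡⅓ε+B : ⅓ ℚ.* (ε ℚ.* K) ≡ ⅓ ℚ.* ε ℚ.+ B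
  ⅓εK≡⅓ε+B = trans
    (solve 3 (λ e b r → con ⅓ :* (e :* (con 1ℚ :+ con 3ℚ :* (b :* r)))
                     := con ⅓ :* e :+ b :* (e :* r)) refl ε B (inv ε))
    (cong (⅓ ℚ.* ε ℚ.+_) (trans (cong (B ℚ.*_) (inv-*ʳ ε (<⇒≢0 0<ε))) (ℚ.*-identityʳ B)))

  B≤⅓εK : B ℚ.≤ ⅓ ℚ.* (ε ℚ.* K)
  B≤⅓εK = subst (B ℚ.≤_) (sym ⅓εK≡⅓ε+B) (q≤p+q B (0≤* (ℚ.nonNegative⁻¹ ⅓) (ℚ.<⇒≤ 0<ε)))

theorem5p6 : (η : ℝ) → 0ℝ < η → η < 1ℝ →
    ( (M : ℝ) →
    Σ[ d ∈ ℕ ] Σ[ n ∈ ℕ ] Σ[ X ∈ Vector (Point d) (suc n) ] Σ[ q ∈ SamplingRule (suc n) ]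
    Σ[ opt ∈ ℝ ] Σ[ 0<opt ∈ 0ℝ < opt ]
    ( Distinct X
    × IsOPT 2 X opt
    × FirstUniform q
    × SupportPreserving 2 X q
    × WithinTV 2 η X q
    × M < expectedCost 2 X q / opt [ 0<opt ] ) )
    ×
    ( ¬ ( Σ[ f ∈ (ℕ → ℝ → ℝ) ] ((k : ℕ) .{{_ : NonZero k}} → Guarantee k η (f k η)) ) )
theorem5p6 η 0<η η<1 = unbounded-ratio η 0<η η<1 , no-guarantee
  where
  no-guarantee : ¬ (Σ[ f ∈ (ℕ → ℝ → ℝ) ] ((k : ℕ) .{{_ : NonZero k}} → Guarantee k η (f k η)))
  no-guarantee (f , guarantee) =
    -- For `k = 2` the claimed bound `f 2 η` is a fixed real, so it can be taken as the `M` that the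
    -- instance exceeds.
    let (_ , _ , X , q , _ , 0<opt , distinct , isOPT , uniform , _ , within , exceeds) =
          unbounded-ratio η 0<η η<1 (f 2 η)
    in  <⇒≱ exceeds (guarantee 2 X q 0<opt distinct isOPT uniform within)
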